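{- If a solution to an instance of TriOrMultiSSR exists, then it is unique. That is, let $\mathcal U,\mathcal V$ be sets, $\mathsf K:\mathcal U\to\mathbb N$ a multiset and $\{\mathsf F_v\}_{v\in\mathcal V}$ a family of multisets in $\mathcal U$ satisfying the Triangular Condition; then there is at most one multiset $\mathsf L:\mathcal V\to\mathbb N$ with $\sum_{v\in\mathcal V}\mathsf L(v)\cdot\mathsf F_v=\mathsf K$.
   Context: $\mathbb N=\{0,1,2,\dots\}$. A multiset in a universe $\mathcal U$ is a function $\mathsf L:\mathcal U\to\mathbb N$ of finite support (all multisets are finite); it contains $u$ if $\mathsf L(u)>0$. TriOrMultiSSR asks, for $\mathsf K$ and $\{\mathsf F_v\}_{v\in\mathcal V}$ (given via oracles), for a multiset $\mathsf L:\mathcal V\to\mathbb N$ with $\sum_{v\in\mathcal V}\mathsf L(v)\mathsf F_v=\mathsf K$, under the Triangular Condition: $\mathcal U$ has a total preorder $\preccurlyeq$ (reflexive, transitive, any two elements comparable, antisymmetry not required); for every $v\in\mathcal V$ the multiset $\mathsf F_v$ contains a unique $\preccurlyeq$-minimal element $\tau(v)\in\mathcal U$; and the map $\tau:\mathcal V\to\mathcal U$ is injective. -}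

module Defs where

open import Data.List using (List; map)
open import Data.List.Membership.Propositional using (_∈_)
open import Data.List.Relation.Unary.Unique.Propositional using (Unique)
open import Data.Nat using (ℕ; _*_; _<_)
open import Data.Nat.ListAction using (sum)
open import Data.Product using (∃!; _×_; proj₁)
open import Function using (_⇔_; Injective)
open import Level using (Level; _⊔_; suc)
open import Relation.Binary.Core using (Rel)
open import Relation.Binary.PropositionalEquality using (_≡_; _≗_)
open import Relation.Binary.Structures using (IsTotalPreorder)

private
  variable
    a b : Level
    U : Set a
    V : Set b

-- Finiteness of the support is witnessed by a duplicate-free enumeration of
-- it.  The enumeration is not part of the identity of a multiset: multisets
-- are the same when their multiplicity functions agree pointwise (_≈ᴹ_).
record Multiset (U : Set a) : Set a where
  field
    mult           : U → ℕ
    support        : List U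
    support-unique : Unique support
    ∈-support      : ∀ u → (u ∈ support) ⇔ (0 < mult u)

open Multiset public

infix 4 _∈ᴹ_ _≈ᴹ_

_∈ᴹ_ : U → Multiset U → Set
u ∈ᴹ M = 0 < mult M u

_≈ᴹ_ : Rel (Multiset U) _
M ≈ᴹ N = mult M ≗ mult N

-- The multiplicity function of Σ_{v ∈ V} L(v) · F_v.  Only v in the support
-- of L contribute, each exactly once, so the value does not depend on the
-- chosen enumeration of that support.
weightedSum : Multiset V → (V → Multiset U) → U → ℕ
weightedSum L F u = sum (map (λ v → mult L v * mult (F v) u) (support L))

IsSolution : Multiset U → (V → Multiset U) → Multiset V → Set _
IsSolution K F L = weightedSum L F ≗ mult K

-- The relation need not be antisymmetric, so an element of M below u only
-- has to be equivalent to u, not equal to it.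
IsMinimalIn : ∀ {ℓ} → Rel U ℓ → Multiset U → U → Set _
IsMinimalIn _≼_ M u = u ∈ᴹ M × (∀ w → w ∈ᴹ M → w ≼ u → u ≼ w)

record TriangularCondition {U : Set a} {V : Set b} (ℓ : Level)
                           (F : V → Multiset U) : Set (a ⊔ b ⊔ suc ℓ) where
  field
    _≼_             : Rel U ℓ
    isTotalPreorder : IsTotalPreorder _≡_ _≼_
    uniqueMinimal   : ∀ v → ∃! _≡_ (IsMinimalIn _≼_ (F v))

  τ : V → U
  τ v = proj₁ (uniqueMinimal v)

  field
    τ-injective : Injective _≡_ _≡_ τ

{-# OPTIONS --safe #-}

-- Two different solutions L, L′ differ at only finitely many v.  Among these
-- choose v with τ v least.  If F w contains τ v, then either L and L′ agree at
-- w, or τ v ≼ τ w, and then τ v is also minimal in F w, so that τ w ≡ τ v and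
-- w ≡ v.  Hence the two sums differ at τ v exactly in the summand of v.
module Submission where

open import Defs
open import Level using (Level)

open import Data.List using (List; []; _∷_; _++_; map; filter)
open import Data.List.Membership.Propositional using (_∈_)
open import Data.List.Membership.Propositional.Properties
  using (∈-∃++; ∈-++⁺ˡ; ∈-++⁺ʳ; ∈-filter⁺)
open import Data.List.Relation.Binary.Permutation.Propositional.Properties
  using (shift; ∈-resp-↭; map⁺)
open import Data.List.Relation.Unary.All as All using (All; []; _∷_)
open import Data.List.Relation.Unary.All.Properties using (all-filter)
open import Data.List.Relation.Unary.Any using (here; there)
open import Data.List.Relation.Unary.AllPairs using ([]; _∷_)
open import Data.List.Relation.Unary.Unique.Propositional using (Unique)
open import Data.Nat using (ℕ; _+_; _*_; _≤_; _<_; z≤n; _≟_; _<?_; >-nonZero)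
open import Data.Nat.ListAction using (sum)
open import Data.Nat.ListAction.Properties using (sum-↭)
open import Data.Nat.Properties
open import Data.Product using (∃; _×_; _,_; proj₁; proj₂)
open import Data.Sum using (inj₁; inj₂)
open import Function using (Equivalence)
open import Relation.Binary.Core using (Rel)
open import Relation.Binary.Definitions using (Reflexive; Total; Transitive; tri<; tri≈; tri>)
open import Relation.Binary.PropositionalEquality
  using (_≡_; _≢_; refl; sym; trans; cong; ≢-sym)
open import Relation.Binary.Structures using (IsTotalPreorder)
open import Relation.Nullary using (yes; no; ¬?; contradiction)

private
  variable
    a b ℓ : Level
    A : Set a
    U : Set a
    V : Set b

sum-map-mono-≤ : {f g : A → ℕ} → (∀ x → f x ≤ g x) →
                 ∀ xs → sum (map f xs) ≤ sum (map g xs)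
sum-map-mono-≤ f≤g []       = z≤n
sum-map-mono-≤ f≤g (x ∷ xs) = +-mono-≤ (f≤g x) (sum-map-mono-≤ f≤g xs)

sum-map-mono-< : {f g : A → ℕ} → (∀ x → f x ≤ g x) →
                 ∀ {v xs} → v ∈ xs → f v < g v → sum (map f xs) < sum (map g xs)
sum-map-mono-< f≤g {xs = _ ∷ xs} (here refl) fv<gv =
  +-mono-<-≤ fv<gv (sum-map-mono-≤ f≤g xs)
sum-map-mono-< f≤g {xs = x ∷ _}  (there v∈)  fv<gv =
  +-mono-≤-< (f≤g x) (sum-map-mono-< f≤g v∈ fv<gv)

-- Serves to pass from one enumeration of a support to another. An entry with `f x` zero contributes
-- nothing; any other is matched with one occurrence in `ys`, which is then removed. As `xs` has no
-- duplicates, later entries never need the removed occurrence.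
sum-map-support-≤ : (f : A → ℕ) → ∀ {xs ys} → Unique xs →
                    (∀ {x} → x ∈ xs → 0 < f x → x ∈ ys) →
                    sum (map f xs) ≤ sum (map f ys)
sum-map-support-≤ f {[]}     {ys} []          ⊆ys = z≤n
sum-map-support-≤ f {x ∷ xs} {ys} (x∉xs ∷ xs!) ⊆ys with 0 <? f x
... | no  fx≯0 = begin
  f x + sum (map f xs)  ≡⟨ cong (_+ sum (map f xs)) (n≤0⇒n≡0 (≮⇒≥ fx≯0)) ⟩
  sum (map f xs)        ≤⟨ sum-map-support-≤ f xs! (λ z∈ → ⊆ys (there z∈)) ⟩
  sum (map f ys)        ∎
  where open ≤-Reasoning
... | yes fx>0 with ps , qs , refl ← ∈-∃++ (⊆ys (here refl) fx>0) = begin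
  f x + sum (map f xs)          ≤⟨ +-monoʳ-≤ (f x) (sum-map-support-≤ f xs! ⊆ps++qs) ⟩
  f x + sum (map f (ps ++ qs))  ≡⟨ sum-↭ (map⁺ f (shift x ps qs)) ⟨
  sum (map f ys)                ∎
  where
  open ≤-Reasoning
  ⊆ps++qs : ∀ {z} → z ∈ xs → 0 < f z → z ∈ ps ++ qs
  ⊆ps++qs z∈ fz>0 with ∈-resp-↭ (shift x ps qs) (⊆ys (there z∈) fz>0)
  ... | here z≡x = contradiction (sym z≡x) (All.lookup x∉xs z∈)
  ... | there z∈′ = z∈′

least : {_≼_ : Rel A ℓ} → Reflexive _≼_ → Transitive _≼_ → Total _≼_ →
        ∀ x xs → ∃ λ y → y ∈ x ∷ xs × All (y ≼_) (x ∷ xs)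
least ≼-refl ≼-trans total x []        = x , here refl , ≼-refl ∷ []
least ≼-refl ≼-trans total x (x′ ∷ xs)
  with y , y∈ , y≼ ← least ≼-refl ≼-trans total x′ xs
  with total x y
... | inj₁ x≼y = x , here refl , ≼-refl ∷ All.map (≼-trans x≼y) y≼
... | inj₂ y≼x = y , there y∈ , y≼x ∷ y≼

∈ᴹ⇒∈-support : (M : Multiset U) → ∀ {u} → u ∈ᴹ M → u ∈ support M
∈ᴹ⇒∈-support M {u} = Equivalence.from (∈-support M u)

-- The larger of two different multiplicities is positive. Hence all disagreements lie in one finite
-- list.
mult-≢⇒∈-supports : (M N : Multiset U) → ∀ {u} → mult M u ≢ mult N u →
                    u ∈ support M ++ support N
mult-≢⇒∈-supports M N {u} M≢N with <-cmp (mult M u) (mult N u)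
... | tri< M<N _ _ = ∈-++⁺ʳ (support M) (∈ᴹ⇒∈-support N (m<n⇒0<n M<N))
... | tri≈ _ M≡N _ = contradiction M≡N M≢N
... | tri> _ _ N<M = ∈-++⁺ˡ (∈ᴹ⇒∈-support M (m<n⇒0<n N<M))

-- Away from `v`, either the multiplicities agree or `u` does not occur in `F w`, so the summands
-- are equal. Both sums are compared over `support L′`, which contains `v`.
weightedSum-mono-< : (L L′ : Multiset V) (F : V → Multiset U) →
  ∀ {u v} → (∀ w → mult L w ≢ mult L′ w → u ∈ᴹ F w → w ≡ v) →
  u ∈ᴹ F v → mult L v < mult L′ v →
  weightedSum L F u < weightedSum L′ F u
weightedSum-mono-< {V = V} L L′ F {u} {v} agree u∈Fv Lv<L′v = begin-strict
  sum (map (term L)  (support L))   ≤⟨ sum-map-support-≤ (term L) (support-unique L) (λ _ → inSupport) ⟩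
  sum (map (term L)  (support L′))  <⟨ sum-map-mono-< term-≤ v∈L′ (*-monoˡ-< _ ⦃ >-nonZero u∈Fv ⦄ Lv<L′v) ⟩
  sum (map (term L′) (support L′))  ∎
  where
  open ≤-Reasoning
  term : Multiset V → V → ℕ
  term M w = mult M w * mult (F w) u

  v∈L′ : v ∈ support L′
  v∈L′ = ∈ᴹ⇒∈-support L′ (m<n⇒0<n Lv<L′v)

  term-≤ : ∀ w → term L w ≤ term L′ w
  term-≤ w with mult L w ≟ mult L′ w | 0 <? mult (F w) u
  ... | yes L≡L′ | _        = ≤-reflexive (cong (_* _) L≡L′)
  ... | no  L≢L′ | yes u∈Fw with refl ← agree w L≢L′ u∈Fw = *-monoˡ-≤ _ (<⇒≤ Lv<L′v)
  ... | no  _    | no  u∉Fw rewrite n≤0⇒n≡0 (≮⇒≥ u∉Fw) | *-zeroʳ (mult L w) = z≤n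

  inSupport : ∀ {w} → 0 < term L w → w ∈ support L′
  inSupport {w} 0<term =
    -- The corresponding term of `L′` is positive too, so its factor `mult L′ w` cannot vanish.
    ∈ᴹ⇒∈-support L′ (*-cancelʳ-< (mult (F w) u) 0 (mult L′ w) (<-≤-trans 0<term (term-≤ w)))

module _ {F : V → Multiset U} (T : TriangularCondition ℓ F) where
  open TriangularCondition T
  open IsTotalPreorder isTotalPreorder using (total) renaming (refl to ≼-refl; trans to ≼-trans)

  τ-∈ᴹ : ∀ v → τ v ∈ᴹ F v
  τ-∈ᴹ v = proj₁ (proj₁ (proj₂ (uniqueMinimal v)))

  -- In a total preorder minimal elements are least: if `u ≼ τ v`, minimality of `τ v` gives the
  -- converse.
  τ-least : ∀ v {u} → u ∈ᴹ F v → τ v ≼ u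
  τ-least v {u} u∈ with total (τ v) u
  ... | inj₁ τ≼u = τ≼u
  ... | inj₂ u≼τ = proj₂ (proj₁ (proj₂ (uniqueMinimal v))) u u∈ u≼τ

  -- An element below a least one is itself least, hence minimal, and the minimal element is unique.
  τ-unique : ∀ v {u} → u ∈ᴹ F v → u ≼ τ v → τ v ≡ u
  τ-unique v u∈ u≼τ =
    proj₂ (proj₂ (uniqueMinimal v)) (u∈ , λ w w∈ _ → ≼-trans u≼τ (τ-least v w∈))

  least-disagreement : (L L′ : Multiset V) → ∀ {v} → mult L v ≢ mult L′ v →
    ∃ λ m → mult L m ≢ mult L′ m × (∀ w → mult L w ≢ mult L′ w → τ m ≼ τ w)
  least-disagreement L L′ {v} Lv≢L′v
    -- The preorder is pulled back along `τ`. Putting the given disagreement `v` in front makes the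
    -- list nonempty, and the filter ensures that whatever is chosen is a disagreement.
    with m , m∈ , m≼ ← least {_≼_ = λ x y → τ x ≼ τ y} ≼-refl ≼-trans (λ x y → total (τ x) (τ y))
                         v (filter (λ w → ¬? (mult L w ≟ mult L′ w)) (support L ++ support L′))
    = m
    , All.lookup (Lv≢L′v ∷ all-filter _ (support L ++ support L′)) m∈
    , λ w Lw≢L′w → All.lookup m≼ (there (∈-filter⁺ _ (mult-≢⇒∈-supports L L′ Lw≢L′w) Lw≢L′w))

  weightedSum-<-at-τ : (L L′ : Multiset V) → ∀ {m} →
    (∀ w → mult L w ≢ mult L′ w → τ m ≼ τ w) → mult L m < mult L′ m →
    weightedSum L F (τ m) < weightedSum L′ F (τ m)
  weightedSum-<-at-τ L L′ {m} m≼ = weightedSum-mono-< L L′ F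
    (λ w Lw≢L′w τm∈Fw → τ-injective (τ-unique w τm∈Fw (m≼ w Lw≢L′w)))
    (τ-∈ᴹ m)

proposition1p15 : ∀ {a b ℓ : Level} {U : Set a} {V : Set b}
    (K : Multiset U) (F : V → Multiset U) →
    TriangularCondition ℓ F →
    ∀ (L L′ : Multiset V) →
    IsSolution K F L → IsSolution K F L′ → L ≈ᴹ L′
proposition1p15 K F T L L′ solves solves′ v with mult L v ≟ mult L′ v
... | yes Lv≡L′v = Lv≡L′v
... | no  Lv≢L′v
  with m , Lm≢L′m , m≼ ← least-disagreement T L L′ Lv≢L′v
  with <-cmp (mult L m) (mult L′ m)
...   | tri≈ _ Lm≡L′m _ = contradiction Lm≡L′m Lm≢L′m
...   | tri< Lm<L′m _ _ = contradiction (trans (solves _) (sym (solves′ _)))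
          (<⇒≢ (weightedSum-<-at-τ T L L′ m≼ Lm<L′m))
-- Disagreement is symmetric, so `m` stays least when `L` and `L′` are exchanged.
...   | tri> _ _ L′m<Lm = contradiction (trans (solves′ _) (sym (solves _)))
          (<⇒≢ (weightedSum-<-at-τ T L′ L (λ w L′w≢Lw → m≼ w (≢-sym L′w≢Lw)) L′m<Lm))
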